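{- Let $L=\mathbb{N}\cup\{\omega,\dagger\}$ and let $<$ be a well-founded partial order on $L$ extending the usual order of the ordinals $\le\omega$ on $\mathbb{N}\cup\{\omega\}$. Let $\to_{\mathit{BH}}$ be the Buchholz Hydra rewrite relation and let $\rightsquigarrow$ be the rewrite relation induced by the system $\mathit{Star}$ over the signature $L$ (with precedence $>$) on trees. Then ${\to_{\mathit{BH}}}\not\subseteq{\rightsquigarrow^*}$.
   Context: Trees are finite, rooted, unordered; $n(t_1,\ldots,t_k)$ ($k\ge 0$) is the tree with root label $n$ and immediate subtrees $t_1,\ldots,t_k$ (order irrelevant), written $n$ if $k=0$. Buchholz Hydra: a finite tree with nodes labeled from $L=\mathbb{N}\cup\{\omega,\dagger\}$, where (1) $\dagger$ labels only the root, (2) every node directly below the root is labeled $0$, and (3) every remaining node is labeled with an ordinal $\alpha\le\omega$. The relation $\to_{\mathit{BH}}$ is given by the following rules, applied anywhere in the Hydra: (BH$_1$) $x(\vec t_1,\alpha(\vec t_2,0))\to x(\vec t_1,\underbrace{\alpha(\vec t_2),\ldots,\alpha(\vec t_2)}_{k\text{ times}})$ for any $x,\alpha\in L$ and $k\in\mathbb{N}$. (BH$_2$) For a leaf node $x$ labeled with $\alpha$, $0<\alpha<\omega$, find the closest ancestor $y$ of $x$ with $\mathrm{label}(y)\le\alpha$ (it exists by (2)). Let $T'$ be the copy of the subtree rooted at $y$ in which the label of $y$ is changed to $\alpha-1$ and the label of $x$ is changed to $0$. Then the rule is $z(\vec t,\alpha)\to z(\vec t,T')$ for any $z\in L$, where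 the displayed $\alpha$ is the leaf $x$ (i.e. the leaf $x$ is replaced by $T'$). (BH$_3$) $z(\vec t,\omega)\to z(\vec t,k)$ for any $z\in L$ and $k\in\mathbb{N}$, where $\omega$ and $k$ are leaves. Star system: let $L^\star=\{f^\star\mid f\in L\}$ be a set of fresh symbols. $\rightsquigarrow$ is the rewrite relation on trees labeled over $L\cup L^\star$ given by the following rules (applicable at any subtree), for all $f,g\in L$ and finite, possibly empty, vectors $\vec x,\vec y,\vec z$ of trees: (put) $f(\vec x)\rightsquigarrow f^\star(\vec x)$; (select) $f^\star(\vec x,y,\vec z)\rightsquigarrow y$; (copy) $f^\star(\vec x)\rightsquigarrow g(f^\star(\vec x),\ldots,f^\star(\vec x))$ with $0$ or more copies, if $f>g$; (down) $f^\star(\vec x,g(\vec y),\vec z)\rightsquigarrow f(\vec x,g^\star(\vec y),\ldots,g^\star(\vec y),\vec z)$ with $0$ or more copies of $g^\star(\vec y)$. $\rightsquigarrow^*$ is the reflexive-transitive closure of $\rightsquigarrow$. -}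

module Defs where

open import Data.List.Base using (List; []; _∷_; _++_; replicate)
open import Data.List.Relation.Binary.Permutation.Homogeneous using (Permutation)
open import Data.List.Relation.Unary.All using (All)
open import Data.Nat.Base using (ℕ; suc)
import Data.Nat.Base as ℕ
open import Data.Product.Base using (Σ; ∃; _×_; _,_)
open import Level using (0ℓ; _⊔_)
open import Relation.Binary.Construct.Closure.ReflexiveTransitive using (Star)
open import Relation.Binary.Construct.Union using (_∪_)
open import Relation.Binary.Core using (Rel)
open import Relation.Binary.PropositionalEquality.Core using (_≡_)
open import Relation.Nullary.Construct.Add.Supremum using (_⁺; [_]; ⊤⁺)
open import Relation.Nullary.Negation.Core using (¬_)
open import Relation.Unary using (Pred)

import Relation.Binary.Construct.Add.Supremum.NonStrict ℕ._≤_ as NonStrict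
import Relation.Binary.Construct.Add.Supremum.Strict ℕ._<_ as Strict

------------------------------------------------------------------------
-- Unordered trees

data Tree {a} (A : Set a) : Set a where
  node : A → List (Tree A) → Tree A

module _ {a} {A : Set a} where

  pattern leaf x = node x []

  infix 4 _≅_

  -- An unordered tree is an ordered one up to _≅_, which reorders siblings
  -- at every depth.
  data _≅_ : Rel (Tree A) a where
    node : ∀ {x ts us} → Permutation _≅_ ts us → node x ts ≅ node x us

  data AllNodes {p} (P : Pred A p) : Pred (Tree A) (a ⊔ p) where
    node : ∀ {x ts} → P x → All (AllNodes P) ts → AllNodes P (node x ts)

  -- One-hole contexts, outermost node first. Each entry holds the label of a
  -- node on the path to the hole and the siblings of its child on that path;
  -- that child comes first, which is no restriction up to _≅_.
  Context : Set a
  Context = List (A × List (Tree A))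

  infix 8 _⟦_⟧

  _⟦_⟧ : Context → Tree A → Tree A
  []             ⟦ t ⟧ = t
  ((x , us) ∷ C) ⟦ t ⟧ = node x (C ⟦ t ⟧ ∷ us)

  -- A single application of a rule in some context, on unordered trees.
  data Rewrite {r} (Rule : Rel (Tree A) r) : Rel (Tree A) (a ⊔ r) where
    step : ∀ {s t l r} (C : Context) →
           s ≅ C ⟦ l ⟧ → Rule l r → C ⟦ r ⟧ ≅ t → Rewrite Rule s t

  -- Reflexivity is up to _≅_, being equality of unordered trees.
  Rewrite* : ∀ {r} → Rel (Tree A) r → Rel (Tree A) (a ⊔ r)
  Rewrite* Rule = Star (_≅_ ∪ Rewrite Rule)

mapTree  : ∀ {a b} {A : Set a} {B : Set b} → (A → B) → Tree A → Tree B
mapTrees : ∀ {a b} {A : Set a} {B : Set b} → (A → B) →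
           List (Tree A) → List (Tree B)

mapTree f (node x ts) = node (f x) (mapTrees f ts)

mapTrees f []       = []
mapTrees f (t ∷ ts) = mapTree f t ∷ mapTrees f ts

------------------------------------------------------------------------
-- Labels

-- The ordinals ≤ ω: ℕ with a greatest element added.
Ordinal : Set
Ordinal = ℕ ⁺

infix 4 _<ᵒ_ _≤ᵒ_

_<ᵒ_ _≤ᵒ_ : Rel Ordinal 0ℓ
_<ᵒ_ = Strict._<⁺_
_≤ᵒ_ = NonStrict._≤⁺_

data L : Set where
  ord : Ordinal → L
  †   : L

pattern fin n = ord [ n ]
pattern ω     = ord ⊤⁺

IsOrd : Pred L 0ℓ
IsOrd x = ∃ λ α → x ≡ ord α

infix 4 _≤ᴸ_

-- † is related to nothing: it is not an ordinal.
data _≤ᴸ_ : Rel L 0ℓ where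
  ord : ∀ {α β} → α ≤ᵒ β → ord α ≤ᴸ ord β

------------------------------------------------------------------------
-- Buchholz Hydras

data BelowRoot : Pred (Tree L) 0ℓ where
  node : ∀ {ts} → All (AllNodes IsOrd) ts → BelowRoot (node (fin 0) ts)

data IsHydra : Pred (Tree L) 0ℓ where
  node : ∀ {ts} → All BelowRoot ts → IsHydra (node † ts)

Hydra : Set
Hydra = Σ (Tree L) IsHydra

data BHRule : Rel (Tree L) 0ℓ where

  bh₁ : ∀ {x α ts₁ ts₂} (k : ℕ) →
        BHRule (node x (node α (leaf (fin 0) ∷ ts₂) ∷ ts₁))
               (node x (replicate k (node α ts₂) ++ ts₁))

  -- With α = m + 1 the label of the leaf being replaced, the left-hand side is
  -- the subtree at its closest ancestor with label ≤ α: that ancestor has label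
  -- β, and D is the path strictly between it and the leaf. Such an ancestor is
  -- never the root of a hydra, by the definition of _≤ᴸ_.
  bh₂ : ∀ {β m us} (D : Context) →
        β ≤ᴸ fin (suc m) →
        All (λ (γ , _) → ¬ (γ ≤ᴸ fin (suc m))) D →
        BHRule (node β (D ⟦ leaf (fin (suc m)) ⟧ ∷ us))
               (node β (D ⟦ node (fin m) (D ⟦ leaf (fin 0) ⟧ ∷ us) ⟧ ∷ us))

  bh₃ : ∀ {z ts} (k : ℕ) →
        BHRule (node z (leaf ω ∷ ts)) (node z (leaf (fin k) ∷ ts))

infix 4 _→BH_

_→BH_ : Rel Hydra 0ℓ
(s , _) →BH (t , _) = Rewrite BHRule s t

------------------------------------------------------------------------
-- The system Star over a signature with precedence _<_

-- The signature F ∪ F⋆.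
data Starred {a} (F : Set a) : Set a where
  plain : F → Starred F
  _⋆    : F → Starred F

module _ {a ℓ} {F : Set a} (_<_ : Rel F ℓ) where

  data StarRule : Rel (Tree (Starred F)) (a ⊔ ℓ) where

    put    : ∀ {f xs} → StarRule (node (plain f) xs) (node (f ⋆) xs)

    select : ∀ {f y} xs {zs} → StarRule (node (f ⋆) (xs ++ y ∷ zs)) y

    copy   : ∀ {f g xs} (k : ℕ) → g < f →
             StarRule (node (f ⋆) xs)
                      (node (plain g) (replicate k (node (f ⋆) xs)))

    down   : ∀ {f g ys} xs {zs} (k : ℕ) →
             StarRule (node (f ⋆) (xs ++ node (plain g) ys ∷ zs))
                      (node (plain f) (xs ++ replicate k (node (g ⋆) ys) ++ zs))

  StarReduces : Rel (Tree F) (a ⊔ ℓ)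
  StarReduces s t = Rewrite* StarRule (mapTree plain s) (mapTree plain t)

{-# OPTIONS --safe #-}
module Submission where

-- The Star system is a presentation of the multiset path order, so it suffices
-- to find a hydra step along which that order does not decrease. When a leaf n
-- with 0 < n < ω has a parent with a larger label, BH₂ puts a copy of that large
-- label in the place of n, where n does not dominate it;
-- for example
--
--   †(0(ω(1)))  →  †(0(ω(0(ω(0)))))
--
-- To see that Star cannot imitate it, trees are bounded from above. For a set P
-- of trees, Below x P is the set of trees at most x(ts), for some ts drawn from
-- P (or itself in P): each path from the root runs through labels < x until it
-- ends or meets a node x with all its children in P, or a tree of P. If P is
-- closed under Star then so is Below x P (below-invariant). Starting from the
-- empty set this gives closed sets
--
--   Below₁ = Below 1 ∅,   Belowω = Below ω Below₁,   Below† = Below † Belowω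
--
-- and the left-hand side is in Below†. The right-hand side is not: no tree in
-- Below₁ contains ω, hence in a tree of Belowω no ω is above another ω. So
-- 0(ω(0(ω(0)))) is not in Belowω, where a child of a node † in Below† must be.
--
-- This argument does not depend on how < relates † to the ordinals: if a tree
-- with root † is in Below† because it is already in Belowω, its children are in
-- Belowω too, closed sets being closed under immediate subtrees.

open import Defs
open import Data.List.Base using (List; []; _∷_; _++_; replicate)
open import Data.List.Relation.Binary.Permutation.Homogeneous
  using (Permutation; refl; prep; swap; trans)
open import Data.List.Relation.Binary.Pointwise.Base using (Pointwise; []; _∷_)
open import Data.List.Relation.Unary.All using (All; []; _∷_; head)
open import Data.List.Relation.Unary.All.Properties
  using (++⁺; ++⁻ˡ; ++⁻ʳ; replicate⁺)
open import Data.Nat.Base using (z≤n)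
open import Data.Product.Base using (_,_; proj₁)
open import Data.Sum.Base using (inj₁; inj₂)
open import Function.Base using (_on_)
open import Induction.WellFounded using (WellFounded)
open import Level using (_⊔_)
open import Relation.Binary.Construct.Add.Supremum.NonStrict using ([_])
open import Relation.Binary.Construct.Add.Supremum.Strict using ([_]<⊤⁺)
open import Relation.Binary.Construct.Closure.ReflexiveTransitive using (ε; _◅_)
open import Relation.Binary.Core using (Rel; _⇒_)
open import Relation.Binary.Definitions using (Transitive)
open import Relation.Binary.PropositionalEquality.Core using (_≡_; refl)
open import Relation.Binary.Structures using (IsStrictPartialOrder)
open import Relation.Nullary.Negation.Core using (¬_)
open import Relation.Unary using (Pred; ∅)

------------------------------------------------------------------------
-- Unordered trees

module _ {a} {A : Set a} where

  ≅-refl  : (t : Tree A) → t ≅ t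
  ≅-refls : (ts : List (Tree A)) → Pointwise _≅_ ts ts

  ≅-refl (node x ts) = node (refl (≅-refls ts))

  ≅-refls []       = []
  ≅-refls (t ∷ ts) = ≅-refl t ∷ ≅-refls ts

------------------------------------------------------------------------
-- Sets of trees closed under Star

-- The label without its star, if it has one.
base : ∀ {a} {F : Set a} → Starred F → F
base (plain f) = f
base (f ⋆)     = f

module _ {a ℓ} {F : Set a} (_<_ : Rel F ℓ) where

  -- A set of unordered trees that is closed under Star steps.
  record Invariant {p} (P : Pred (Tree (Starred F)) p) : Set (a ⊔ ℓ ⊔ p) where
    field
      resp : ∀ {s t} → s ≅ t → P s → P t
      pres : ∀ {l r} (C : Context) → StarRule _<_ l r → P (C ⟦ l ⟧) → P (C ⟦ r ⟧)

  open Invariant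

  module _ {p} {P : Pred (Tree (Starred F)) p} (inv : Invariant P) where

    invariant* : ∀ {s t} → Rewrite* (StarRule _<_) s t → P s → P t
    invariant* ε                                ps = ps
    invariant* (inj₁ s≅t ◅ rest)                ps =
      invariant* rest (resp inv s≅t ps)
    invariant* (inj₂ (step C s≅ rule ≅t) ◅ rest) ps =
      invariant* rest (resp inv ≅t (pres inv C rule (resp inv s≅ ps)))

    -- By put followed by select.
    invariant-child : ∀ {f t ts} → P (node (plain f) (t ∷ ts)) → P t
    invariant-child pt = pres inv [] (select []) (pres inv [] put pt)

  -- The trees that are, in the multiset path order, at most x(ts) for some ts in
  -- P, or that belong to P. Stars on labels are ignored.
  data Below {p} (x : F) (P : Pred (Tree (Starred F)) p) :
             Pred (Tree (Starred F)) (a ⊔ ℓ ⊔ p) where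
    top     : ∀ {y ts} → base y ≡ x → All P ts → Below x P (node y ts)
    smaller : ∀ {y ts} → base y < x → All (Below x P) ts → Below x P (node y ts)
    inside  : ∀ {t} → P t → Below x P t

  module _ {p} {x : F} {P : Pred (Tree (Starred F)) p}
           (<-trans : Transitive _<_) (inv : Invariant P) where

    below-resp    : ∀ {s t} → s ≅ t → Below x P s → Below x P t
    below-resp-↭  : ∀ {ss ts} → Permutation _≅_ ss ts →
                    All (Below x P) ss → All (Below x P) ts
    below-resp-≋  : ∀ {ss ts} → Pointwise _≅_ ss ts →
                    All (Below x P) ss → All (Below x P) ts
    inside-resp-↭ : ∀ {ss ts} → Permutation _≅_ ss ts → All P ss → All P ts
    inside-resp-≋ : ∀ {ss ts} → Pointwise _≅_ ss ts → All P ss → All P ts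

    below-resp (node ↭) (top eq ps)     = top eq (inside-resp-↭ ↭ ps)
    below-resp (node ↭) (smaller lt bs) = smaller lt (below-resp-↭ ↭ bs)
    below-resp s≅t      (inside ps)     = inside (resp inv s≅t ps)

    below-resp-↭ (refl eqs)       bs           = below-resp-≋ eqs bs
    below-resp-↭ (prep eq ↭)      (b ∷ bs)     =
      below-resp eq b ∷ below-resp-↭ ↭ bs
    below-resp-↭ (swap eq eq′ ↭)  (b ∷ c ∷ bs) =
      below-resp eq′ c ∷ below-resp eq b ∷ below-resp-↭ ↭ bs
    below-resp-↭ (trans ↭₁ ↭₂)    bs           =
      below-resp-↭ ↭₂ (below-resp-↭ ↭₁ bs)

    below-resp-≋ []         []       = []
    below-resp-≋ (eq ∷ eqs) (b ∷ bs) = below-resp eq b ∷ below-resp-≋ eqs bs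

    inside-resp-↭ (refl eqs)      ps           = inside-resp-≋ eqs ps
    inside-resp-↭ (prep eq ↭)     (p ∷ ps)     =
      resp inv eq p ∷ inside-resp-↭ ↭ ps
    inside-resp-↭ (swap eq eq′ ↭) (p ∷ q ∷ ps) =
      resp inv eq′ q ∷ resp inv eq p ∷ inside-resp-↭ ↭ ps
    inside-resp-↭ (trans ↭₁ ↭₂)   ps           =
      inside-resp-↭ ↭₂ (inside-resp-↭ ↭₁ ps)

    inside-resp-≋ []         []       = []
    inside-resp-≋ (eq ∷ eqs) (p ∷ ps) = resp inv eq p ∷ inside-resp-≋ eqs ps

    below-put : ∀ {f ts} → Below x P (node (plain f) ts) →
                Below x P (node (f ⋆) ts)
    below-put (top eq ps)     = top eq ps
    below-put (smaller lt bs) = smaller lt bs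
    below-put (inside pt)     = inside (pres inv [] put pt)

    below-rule : ∀ {l r} → StarRule _<_ l r → Below x P l → Below x P r
    below-rule rule             (inside pl)     = inside (pres inv [] rule pl)
    below-rule put              b               = below-put b
    below-rule (select xs)      (top _ ps)      = inside (head (++⁻ʳ xs ps))
    below-rule (select xs)      (smaller _ bs)  = head (++⁻ʳ xs bs)
    below-rule (copy k g<x)     (top refl ps)   =
      smaller g<x (replicate⁺ k (top refl ps))
    below-rule (copy k g<f)     (smaller lt bs) =
      smaller (<-trans g<f lt) (replicate⁺ k (smaller lt bs))
    below-rule (down xs k)      (top eq ps)     with ++⁻ʳ xs ps
    ... | q ∷ qs =
      top eq (++⁺ (++⁻ˡ xs ps) (++⁺ (replicate⁺ k (pres inv [] put q)) qs))
    below-rule (down xs k)      (smaller lt bs) with ++⁻ʳ xs bs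
    ... | c ∷ cs =
      smaller lt (++⁺ (++⁻ˡ xs bs) (++⁺ (replicate⁺ k (below-put c)) cs))

    below-pres : ∀ {l r} (C : Context) → StarRule _<_ l r →
                 Below x P (C ⟦ l ⟧) → Below x P (C ⟦ r ⟧)
    below-pres []      rule b                     = below-rule rule b
    below-pres (_ ∷ C) rule (top eq (p ∷ ps))     = top eq (pres inv C rule p ∷ ps)
    below-pres (_ ∷ C) rule (smaller lt (b ∷ bs)) =
      smaller lt (below-pres C rule b ∷ bs)
    below-pres (c ∷ C) rule (inside pt)           =
      inside (pres inv (c ∷ C) rule pt)

    below-invariant : Invariant (Below x P)
    below-invariant .resp = below-resp
    below-invariant .pres = below-pres

  ∅-invariant : Invariant ∅
  ∅-invariant .resp _ ()
  ∅-invariant .pres _ _ ()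

------------------------------------------------------------------------
-- The hydra step

-- †(0(ω(1)))
source : Tree L
source = node † (node (fin 0) (node ω (leaf (fin 1) ∷ []) ∷ []) ∷ [])

-- †(0(ω(0(ω(0)))))
target : Tree L
target =
  node † (node (fin 0) (node ω
    (node (fin 0) (node ω (leaf (fin 0) ∷ []) ∷ []) ∷ []) ∷ []) ∷ [])

source-hydra : IsHydra source
source-hydra =
  node (node (node (_ , refl) (node (_ , refl) [] ∷ []) ∷ []) ∷ [])

target-hydra : IsHydra target
target-hydra =
  node (node (node (_ , refl) (node (_ , refl)
    (node (_ , refl) (node (_ , refl) [] ∷ []) ∷ []) ∷ []) ∷ []) ∷ [])

-- BH₂ at the leaf 1: the node ω is passed over, and the closest ancestor with
-- label ≤ 1 is the node 0.
source→target : (source , source-hydra) →BH (target , target-hydra)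
source→target =
  step ((† , []) ∷ []) (≅-refl _)
       (bh₂ ((ω , []) ∷ []) (ord [ z≤n ]) ((λ { (ord ()) }) ∷ []))
       (≅-refl _)

------------------------------------------------------------------------
-- Separating source and target

module _ {ℓ} (_<_ : Rel L ℓ) (isSPO : IsStrictPartialOrder _≡_ _<_)
         (extends : ∀ {α β} → α <ᵒ β → ord α < ord β) where

  open IsStrictPartialOrder isSPO
    using (irrefl; asym) renaming (trans to <-trans)

  Below₁ Belowω Below† : Pred (Tree (Starred L)) ℓ
  Below₁ = Below _<_ (fin 1) ∅
  Belowω = Below _<_ ω Below₁
  Below† = Below _<_ † Belowω

  below₁-invariant : Invariant _<_ Below₁
  below₁-invariant = below-invariant _<_ <-trans (∅-invariant _<_)

  belowω-invariant : Invariant _<_ Belowω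
  belowω-invariant = below-invariant _<_ <-trans below₁-invariant

  below†-invariant : Invariant _<_ Below†
  below†-invariant = below-invariant _<_ <-trans belowω-invariant

  source∈Below† : Below† (mapTree plain source)
  source∈Below† =
    top refl (smaller (extends [ _ ]<⊤⁺) (top refl (top refl [] ∷ []) ∷ []) ∷ [])

  ω∉Below₁ : ∀ {ts} → ¬ Below₁ (node (plain ω) ts)
  ω∉Below₁ (top () _)
  ω∉Below₁ (smaller ω<1 _) = asym ω<1 (extends [ _ ]<⊤⁺)

  ω-children : ∀ {ts} → Belowω (node (plain ω) ts) → All Below₁ ts
  ω-children (top _ bs)      = bs
  ω-children (smaller ω<ω _) with () ← irrefl refl ω<ω
  ω-children (inside b)      with () ← ω∉Below₁ b

  †-child : ∀ {t} → Below† (node (plain †) (t ∷ [])) → Belowω t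
  †-child (top _ (b ∷ [])) = b
  †-child (smaller †<† _)  with () ← irrefl refl †<†
  †-child (inside b)       = invariant-child _<_ belowω-invariant b

  target∉Below† : ¬ Below† (mapTree plain target)
  target∉Below† b
    with 0ω0∈Below₁ ∷ [] ← ω-children
           (invariant-child _<_ belowω-invariant (†-child b))
    = ω∉Below₁ (invariant-child _<_ below₁-invariant 0ω0∈Below₁)

lemma6p8 : ∀ {ℓ} (_<_ : Rel L ℓ) →
    IsStrictPartialOrder _≡_ _<_ →
    WellFounded _<_ →
    (∀ {α β} → α <ᵒ β → ord α < ord β) →
    ¬ (_→BH_ ⇒ (StarReduces _<_ on proj₁))
lemma6p8 _<_ isSPO _ extends BH⊆Star =
  target∉Below† _<_ isSPO extends
    (invariant* _<_ (below†-invariant _<_ isSPO extends)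
      (BH⊆Star {source , source-hydra} {target , target-hydra} source→target)
      (source∈Below† _<_ isSPO extends))
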